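{- Let $F_0,F_1$ be an affine pair of communicating SR-machines. If the protocol is deadlock-free, then it has the bounded channel property if and only if neither $F_0$ nor $F_1$ has a send cycle.
   Context: A pair of communicating SR-machines is a CFSM protocol with communication graph having nodes $\{0,1\}$ and two edges $\alpha$ (from $0$ to $1$) and $\beta$ (from $1$ to $0$), disjoint finite message alphabets $M_\alpha,M_\beta$, and two finite state machines $F_j=(K_j,\Sigma_j,T_j,h_j)$, $j=0,1$, with $\Sigma_0=\{ -b:b\in M_\alpha\}\cup\{+b:b\in M_\beta\}$, $\Sigma_1=\{ -b:b\in M_\beta\}\cup\{+b:b\in M_\alpha\}$, $K_j$ finite, $h_j\in K_j$ initial, $T_j\subseteq K_j\times\Sigma_j\times K_j$ (transitions written $p\xrightarrow{e}q$; $+b$ = receive, $-b$ = send; $p\xrightarrow{w}q$ for $w\in\Sigma_j^*$ means a directed path labelled $w$). A state is a send state if it has no outgoing $+b$ transition and a receive state if it has no outgoing $-b$ transition. $F_j$ is an SR-machine if every state is a send or a receive state, its transition diagram is strongly connected, and $p\xrightarrow{e}q_1$, $p\xrightarrow{e}q_2$ imply $q_1=q_2$. Global states are $((p_0,p_1),(x_\alpha,x_\beta))$; initially $((h_0,h_1),(\lambda,\lambda))$. A step is either a send (a machine performs $p\xrightarrow{ -b}q$ and $b$ is appended to its output channel: $\alpha$ for $F_0$, $\beta$ for $F_1$) or a receive (a machine performs $p\xrightarrow{+b}q$ and $b$ is removed from the front of its input channel, $\beta$ for $F_0$, $\alpha$ for $F_1$, which must begin with $b$); the other machine is unchanged. Reachable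 means reachable from the initial global state. A global state is deadlocked if both components are receive states and both channels are empty; the protocol is deadlock-free if no deadlocked global state is reachable. It has the bounded channel property if $|x_\alpha|+|x_\beta|$ is bounded over all reachable global states. $\pi_\alpha(w)$ (resp. $\pi_\beta(w)$) is the string of symbols of $M_\alpha$ (resp. $M_\beta$) occurring in $w$, in order, signs removed; $\mathbf Z_j=\{(\pi_\alpha(w),\pi_\beta(w)): h_j\xrightarrow{w}h_j \text{ in } F_j\}$; the pair is affine if $\mathbf Z_0=\mathbf Z_1$. A send cycle of $F_j$ is a directed cycle in its transition diagram all of whose labels are of the form $-b$. -}

module Defs where

open import Data.Bool.Base using (Bool; true)
open import Data.Fin.Base using (Fin)
open import Data.List.Base using (List; []; _∷_; _∷ʳ_; length)
open import Data.List.Relation.Unary.All using (All)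
open import Data.Nat.Base using (ℕ; _+_; _≤_)
open import Data.Product.Base using (∃; _×_; _,_)
open import Data.Sum.Base using (_⊎_)
open import Level using (0ℓ)
open import Relation.Binary.Construct.Closure.ReflexiveTransitive using (Star)
open import Relation.Binary.PropositionalEquality.Core using (_≡_; _≢_)
open import Relation.Nullary.Negation.Core using (¬_)
open import Relation.Unary using (Pred; _≐_)

-- send b is −b, recv b is +b.  The alphabets of outgoing and incoming messages
-- are separate types, so the two message alphabets are disjoint.
data Label (Out In : Set) : Set where
  send : Out → Label Out In
  recv : In → Label Out In

module _ {Out In : Set} where

  sent : List (Label Out In) → List Out
  sent []           = []
  sent (send b ∷ w) = b ∷ sent w
  sent (recv b ∷ w) = sent w

  received : List (Label Out In) → List In
  received []           = []
  received (send b ∷ w) = received w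
  received (recv b ∷ w) = b ∷ received w

-- A finite state machine with o outgoing and i incoming messages; the set of
-- transitions is given by its characteristic function.
record Machine (o i : ℕ) : Set where
  field
    size       : ℕ
    transition : Fin size → Label (Fin o) (Fin i) → Fin size → Bool
    initial    : Fin size

  State : Set
  State = Fin size

  Sym : Set
  Sym = Label (Fin o) (Fin i)

  infix 4 _─[_]→_ _─[_]→*_

  _─[_]→_ : State → Sym → State → Set
  p ─[ e ]→ q = transition p e q ≡ true

  data _─[_]→*_ : State → List Sym → State → Set where
    []  : ∀ {p} → p ─[ [] ]→* p
    _∷_ : ∀ {p e q w r} → p ─[ e ]→ q → q ─[ w ]→* r → p ─[ e ∷ w ]→* r

  SendState : Pred State 0ℓ
  SendState p = ∀ b q → ¬ (p ─[ recv b ]→ q)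

  ReceiveState : Pred State 0ℓ
  ReceiveState p = ∀ b q → ¬ (p ─[ send b ]→ q)

  SendCycle : State → List Sym → Set
  SendCycle p w = w ≢ [] × All (λ e → ∃ λ b → e ≡ send b) w × p ─[ w ]→* p

  HasSendCycle : Set
  HasSendCycle = ∃ λ p → ∃ λ w → SendCycle p w

record IsSRMachine {o i : ℕ} (F : Machine o i) : Set where
  open Machine F
  field
    sendOrReceive     : ∀ p → SendState p ⊎ ReceiveState p
    stronglyConnected : ∀ p q → ∃ λ w → p ─[ w ]→* q
    deterministic     : ∀ {p e q₁ q₂} → p ─[ e ]→ q₁ → p ─[ e ]→ q₂ → q₁ ≡ q₂

-- F₀ writes to channel α (messages Fin a) and reads from β (messages Fin b);
-- F₁ writes to β and reads from α.
module Protocol {a b : ℕ} (F₀ : Machine a b) (F₁ : Machine b a) where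

  private
    module F₀ = Machine F₀
    module F₁ = Machine F₁

  record GlobalState : Set where
    constructor ⟨_,_∣_,_⟩
    field
      state₀ : F₀.State
      state₁ : F₁.State
      chanα  : List (Fin a)
      chanβ  : List (Fin b)

  open GlobalState

  initialState : GlobalState
  initialState = ⟨ F₀.initial , F₁.initial ∣ [] , [] ⟩

  data Step : GlobalState → GlobalState → Set where
    send₀ : ∀ {p q r m x y} → p F₀.─[ send m ]→ q →
            Step ⟨ p , r ∣ x , y ⟩ ⟨ q , r ∣ x ∷ʳ m , y ⟩
    recv₀ : ∀ {p q r m x y} → p F₀.─[ recv m ]→ q →
            Step ⟨ p , r ∣ x , m ∷ y ⟩ ⟨ q , r ∣ x , y ⟩
    send₁ : ∀ {p q r m x y} → p F₁.─[ send m ]→ q →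
            Step ⟨ r , p ∣ x , y ⟩ ⟨ r , q ∣ x , y ∷ʳ m ⟩
    recv₁ : ∀ {p q r m x y} → p F₁.─[ recv m ]→ q →
            Step ⟨ r , p ∣ m ∷ x , y ⟩ ⟨ r , q ∣ x , y ⟩

  Reachable : Pred GlobalState 0ℓ
  Reachable = Star Step initialState

  Deadlocked : Pred GlobalState 0ℓ
  Deadlocked s = F₀.ReceiveState (state₀ s) × F₁.ReceiveState (state₁ s)
               × chanα s ≡ [] × chanβ s ≡ []

  DeadlockFree : Set
  DeadlockFree = ∀ s → Reachable s → ¬ Deadlocked s

  BoundedChannels : Set
  BoundedChannels = ∃ λ B → ∀ s → Reachable s → length (chanα s) + length (chanβ s) ≤ B

  -- On words of F₀ the projections π_α and π_β are sent and received; on words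
  -- of F₁ they are received and sent.
  Z₀ Z₁ : Pred (List (Fin a) × List (Fin b)) 0ℓ
  Z₀ (x , y) = ∃ λ w → F₀.initial F₀.─[ w ]→* F₀.initial × sent w ≡ x × received w ≡ y
  Z₁ (x , y) = ∃ λ w → F₁.initial F₁.─[ w ]→* F₁.initial × received w ≡ x × sent w ≡ y

  Affine : Set
  Affine = Z₀ ≐ Z₁

{-# OPTIONS --safe #-}

-- Two paths whose projections match can be executed jointly: they could only
-- get stuck with both machines waiting on empty channels, a deadlock.  By
-- affinity every state of F₀ lies on a path with a matching partner, hence it
-- is reachable, and a send cycle through it could be pumped.
--
-- Conversely, without send cycles the number of sends along a path is linearly
-- bounded by the number of receives, and by affinity vice versa.  Let w₀, w₁
-- be the paths taken by F₀ and F₁ to a reachable global state, and close w₀ by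
-- a short path v to a loop at the initial state.  Affinity yields a matching
-- loop w′ of F₁, and determinism makes w₁ and w′ agree until F₁ has sent
-- everything F₀ has received.  From there on w′ sends only what v receives, so
-- it is short; hence so is what remains of w₁, and so are the channels.
module Submission where

open import Data.Empty using (⊥-elim)
open import Data.Fin.Base as Fin using (Fin; zero; suc)
open import Data.Fin.Properties using (pigeonhole)
open import Data.List.Base using (List; []; _∷_; _++_; _∷ʳ_; length)
open import Data.List.Properties using (++-assoc; ++-identityʳ; ∷-injectiveˡ; ∷-injectiveʳ; length-++)
open import Data.List.Relation.Unary.All using (All; []; _∷_)
open import Data.Nat.Base using (ℕ; zero; suc; _+_; _*_; _≤_; _<_; _⊔_; z≤n; s≤s; s<s⁻¹)
open import Data.Nat.Properties
open import Data.Product.Base using (∃; ∃₂; _×_; _,_; proj₁; proj₂)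
open import Data.Sum.Base using (inj₁; inj₂)
open import Function.Base using (_∘_)
open import Function.Bundles using (_⇔_; mk⇔)
open import Relation.Binary.Construct.Closure.ReflexiveTransitive using (Star; ε; _◅_; _◅◅_; gmap)
open import Relation.Binary.PropositionalEquality using (_≡_; _≢_; refl; sym; trans; cong; subst)
open import Relation.Nullary using (yes; no)
open import Relation.Nullary.Negation.Core using (¬_)
open import Defs

-- Maxima over finite sets and projections of words.

bounded : ∀ {n} (f : Fin n → ℕ) → ∃ λ N → ∀ i → f i ≤ N
bounded {zero}  f = 0 , λ ()
bounded {suc n} f with bounded (f ∘ suc)
... | N , f≤N = f zero ⊔ N , λ where
  zero    → m≤m⊔n (f zero) N
  (suc i) → ≤-trans (f≤N i) (m≤n⊔m (f zero) N)

module _ {Out In : Set} where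

  sent-++ : (u v : List (Label Out In)) → sent (u ++ v) ≡ sent u ++ sent v
  sent-++ []           v = refl
  sent-++ (send b ∷ u) v = cong (b ∷_) (sent-++ u v)
  sent-++ (recv b ∷ u) v = sent-++ u v

  received-++ : (u v : List (Label Out In)) → received (u ++ v) ≡ received u ++ received v
  received-++ []           v = refl
  received-++ (send b ∷ u) v = received-++ u v
  received-++ (recv b ∷ u) v = cong (b ∷_) (received-++ u v)

  length-sent-≤ : (w : List (Label Out In)) → length (sent w) ≤ length w
  length-sent-≤ []           = z≤n
  length-sent-≤ (send b ∷ w) = s≤s (length-sent-≤ w)
  length-sent-≤ (recv b ∷ w) = m≤n⇒m≤1+n (length-sent-≤ w)

  length-received-≤ : (w : List (Label Out In)) → length (received w) ≤ length w
  length-received-≤ []           = z≤n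
  length-received-≤ (send b ∷ w) = m≤n⇒m≤1+n (length-received-≤ w)
  length-received-≤ (recv b ∷ w) = s≤s (length-received-≤ w)

-- Runs of sends in the paths of a single machine.

module Paths {o i : ℕ} (F : Machine o i) where

  open Machine F

  IsSend : Sym → Set
  IsSend e = ∃ λ b → e ≡ send b

  single : ∀ {p e q} → p ─[ e ]→ q → p ─[ e ∷ [] ]→* q
  single t = t ∷ []

  infixr 5 _⋯_

  _⋯_ : ∀ {p q r u v} → p ─[ u ]→* q → q ─[ v ]→* r → p ─[ u ++ v ]→* r
  []       ⋯ vs = vs
  (t ∷ us) ⋯ vs = t ∷ (us ⋯ vs)

  stateAt : ∀ {p w q} → p ─[ w ]→* q → Fin (suc (length w)) → State
  stateAt {p = p} ts       zero    = p
  stateAt         (t ∷ ts) (suc k) = stateAt ts k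

  prefix : ∀ {p w q} (ts : p ─[ w ]→* q) → All IsSend w → ∀ k →
           ∃ λ v → All IsSend v × p ─[ v ]→* stateAt ts k
  prefix ts       ss       zero    = [] , [] , []
  prefix (t ∷ ts) (s ∷ ss) (suc k) with prefix ts ss k
  ... | v , ss′ , vs = _ ∷ v , s ∷ ss′ , t ∷ vs

  segment : ∀ {p w q} (ts : p ─[ w ]→* q) → All IsSend w → ∀ {j k} → j Fin.< k →
            ∃ λ v → v ≢ [] × All IsSend v × stateAt ts j ─[ v ]→* stateAt ts k
  segment (t ∷ ts) (s ∷ ss) {zero}  {suc k} j<k with prefix ts ss k
  ... | v , ss′ , vs = _ ∷ v , (λ ()) , s ∷ ss′ , t ∷ vs
  segment (t ∷ ts) (s ∷ ss) {suc j} {suc k} j<k = segment ts ss (s<s⁻¹ j<k)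

  -- By pigeonhole, a longer path would visit some state twice, and the segment between the two
  -- visits would be a send cycle.
  sendPath-short : ¬ HasSendCycle → ∀ {p w q} → p ─[ w ]→* q → All IsSend w → length w ≤ size
  sendPath-short acyclic {w = w} ts ss with length w ≤? size
  ... | yes short = short
  ... | no  long  with pigeonhole (m<n⇒m<1+n (≰⇒> long)) (stateAt ts)
  ...   | j , k , j<k , same with segment ts ss j<k
  ...     | v , v≢[] , ss′ , vs = ⊥-elim (acyclic (_ , v , v≢[] , ss′ ,
              subst (λ r → stateAt ts j ─[ v ]→* r) (sym same) vs))

  -- Form of `sends≤receives` that suits induction: `s` is the run of sends before the first receive
  -- of `w`, not yet charged to anything. A receive put in front of `w` pays for this run, at most
  -- `size` sends, and starts an empty one.
  leadingSends : ¬ HasSendCycle → ∀ {p w q} → p ─[ w ]→* q →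
                 ∃₂ λ s r → p ─[ s ]→* r × All IsSend s ×
                 length (sent w) ≤ length s + length (received w) * size
  leadingSends acyclic [] = [] , _ , [] , [] , z≤n
  leadingSends acyclic (_∷_ {e = send b} t ts) with leadingSends acyclic ts
  ... | s , r , us , ss , sent≤ = send b ∷ s , r , t ∷ us , (b , refl) ∷ ss , s≤s sent≤
  leadingSends acyclic (_∷_ {e = recv b} t ts) with leadingSends acyclic ts
  ... | s , r , us , ss , sent≤ =
    [] , _ , [] , [] , ≤-trans sent≤ (+-monoˡ-≤ _ (sendPath-short acyclic us ss))

  sends≤receives : ¬ HasSendCycle → ∀ {p w q} → p ─[ w ]→* q →
                   length (sent w) ≤ suc (length (received w)) * size
  sends≤receives acyclic ts with leadingSends acyclic ts
  -- The `suc` in the bound pays for the sends before the first receive.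
  ... | s , r , us , ss , sent≤ = ≤-trans sent≤ (+-monoˡ-≤ _ (sendPath-short acyclic us ss))

  -- Consequences of the SR conditions.

  module _ (sr : IsSRMachine F) where

    open IsSRMachine sr

    ¬send∧recv : ∀ {p b c q r} → p ─[ send b ]→ q → ¬ p ─[ recv c ]→ r
    ¬send∧recv {p} t t′ with sendOrReceive p
    ... | inj₁ isSend = isSend _ _ t′
    ... | inj₂ isRecv = isRecv _ _ t

    recv⇒ReceiveState : ∀ {p b q} → p ─[ recv b ]→ q → ReceiveState p
    recv⇒ReceiveState t′ b q t = ¬send∧recv t t′

    -- Strips common transitions from w and w′ until the common part R of what
    -- they send is used up.
    align : ∀ {q w r w′ r′} (R : List (Fin o)) {x y y′} →
            q ─[ w ]→* r → q ─[ w′ ]→* r′ →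
            received w′ ≡ received w ++ x → sent w ≡ R ++ y → sent w′ ≡ R ++ y′ →
            ∃ λ q′ → ∃₂ λ t t′ → q′ ─[ t ]→* r × q′ ─[ t′ ]→* r′ ×
            received t′ ≡ received t ++ x × sent t ≡ y × sent t′ ≡ y′
    align []      us us′ rec snt snt′ = _ , _ , _ , us , us′ , rec , snt , snt′
    align (m ∷ R) [] us′ rec () snt′
    align (m ∷ R) (_∷_ {e = send c} t us) [] rec snt ()
    align (m ∷ R) (_∷_ {e = send c} t us) (_∷_ {e = recv d} t′ us′) rec snt snt′ =
      ⊥-elim (¬send∧recv t t′)
    align (m ∷ R) (_∷_ {e = send c} t us) (_∷_ {e = send d} t′ us′) rec snt snt′
      with refl ← ∷-injectiveˡ snt
      with refl ← ∷-injectiveˡ snt′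
      with refl ← deterministic t t′ =
      align R us us′ rec (∷-injectiveʳ snt) (∷-injectiveʳ snt′)
    align (m ∷ R) (_∷_ {e = recv c} t us) [] () snt snt′
    align (m ∷ R) (_∷_ {e = recv c} t us) (_∷_ {e = send d} t′ us′) rec snt snt′ =
      ⊥-elim (¬send∧recv t′ t)
    align (m ∷ R) (_∷_ {e = recv c} t us) (_∷_ {e = recv d} t′ us′) rec snt snt′
      with refl ← ∷-injectiveˡ rec
      with refl ← deterministic t t′ =
      align (m ∷ R) us us′ (∷-injectiveʳ rec) snt snt′

module _ {a b : ℕ} (F₀ : Machine a b) (F₁ : Machine b a) where

  private
    module F₀ = Machine F₀
    module F₁ = Machine F₁
    module P₀ = Paths F₀
    module P₁ = Paths F₁
    module P = Protocol F₀ F₁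
    module Q = Protocol F₁ F₀
  open F₀ using ([]; _∷_)
  open P using (⟨_,_∣_,_⟩; Step; send₀; recv₀; send₁; recv₁; Reachable)

  -- Symmetry of the protocol under exchange of the two machines.

  swap : Q.GlobalState → P.GlobalState
  swap Q.⟨ p , q ∣ x , y ⟩ = ⟨ q , p ∣ y , x ⟩

  swap-Step : ∀ {s t} → Q.Step s t → Step (swap s) (swap t)
  swap-Step (Q.send₀ t) = send₁ t
  swap-Step (Q.recv₀ t) = recv₁ t
  swap-Step (Q.send₁ t) = send₀ t
  swap-Step (Q.recv₁ t) = recv₀ t

  swap-Reachable : ∀ {s} → Q.Reachable s → Reachable (swap s)
  swap-Reachable = gmap swap swap-Step

  swap-DeadlockFree : P.DeadlockFree → Q.DeadlockFree
  swap-DeadlockFree free s reach (r₀ , r₁ , x≡[] , y≡[]) =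
    free (swap s) (swap-Reachable reach) (r₁ , r₀ , y≡[] , x≡[])

  swap-BoundedChannels : P.BoundedChannels → Q.BoundedChannels
  swap-BoundedChannels (B , bound) = B , λ s reach →
    subst (_≤ B) (+-comm (length (Q.GlobalState.chanβ s)) _) (bound (swap s) (swap-Reachable reach))

  swap-Affine : P.Affine → Q.Affine
  swap-Affine (Z₀⊆Z₁ , Z₁⊆Z₀) = to , from
    where
    to : ∀ {z} → Q.Z₀ z → Q.Z₁ z
    to (w , ws , snt , rec) with Z₁⊆Z₀ (w , ws , rec , snt)
    ... | v , vs , snt′ , rec′ = v , vs , rec′ , snt′
    from : ∀ {z} → Q.Z₁ z → Q.Z₀ z
    from (w , ws , rec , snt) with Z₀⊆Z₁ (w , ws , snt , rec)
    ... | v , vs , rec′ , snt′ = v , vs , snt′ , rec′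

  -- Joint execution of matching paths and pumping of send cycles.

  module _ (sr₀ : IsSRMachine F₀) (sr₁ : IsSRMachine F₁) (affine : P.Affine) where

    private
      module SR₀ = IsSRMachine sr₀
      module SR₁ = IsSRMachine sr₁

    -- `F₀` moves whenever it can, and `F₁` only while `F₀` waits on an empty `β`. The equations say
    -- that the channels and the remaining paths still match. The words `ss` and `rr` allow `w` to
    -- match a longer path of `F₀` of which `u` is only the beginning.
    runJointly : P.DeadlockFree → ∀ {p u p′ q w r x y} (ss : List (Fin a)) (rr : List (Fin b)) →
                 p F₀.─[ u ]→* p′ → q F₁.─[ w ]→* r →
                 x ++ (sent u ++ ss) ≡ received w → y ++ sent w ≡ received u ++ rr →
                 Reachable ⟨ p , q ∣ x , y ⟩ →
                 ∃ λ q′ → ∃₂ λ x′ y′ → Reachable ⟨ p′ , q′ ∣ x′ , y′ ⟩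
    runJointly free ss rr [] ws α β reach = _ , _ , _ , reach
    runJointly free {x = x} ss rr (_∷_ {e = send m} t us) ws α β reach =
      runJointly free ss rr us ws (trans (++-assoc x _ _) α) β (reach ◅◅ send₀ t ◅ ε)
    runJointly free {y = m′ ∷ y} ss rr (_∷_ {e = recv m} t us) ws α β reach
      with refl ← ∷-injectiveˡ β =
      runJointly free ss rr us ws α (∷-injectiveʳ β) (reach ◅◅ recv₀ t ◅ ε)
    -- `F₁` cannot have finished: the message awaited by `F₀` is still to be sent.
    runJointly free {y = []} ss rr (_∷_ {e = recv m} t us) [] α () reach
    runJointly free {y = []} ss rr us@(_∷_ {e = recv m} _ _) (_∷_ {e = send n} t′ ws) α β reach =
      runJointly free ss rr us ws α β (reach ◅◅ send₁ t′ ◅ ε)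
    runJointly free {x = n′ ∷ x} {y = []} ss rr us@(_∷_ {e = recv m} _ _) (_∷_ {e = recv n} t′ ws) α β reach
      with refl ← ∷-injectiveˡ α =
      runJointly free ss rr us ws (∷-injectiveʳ α) β (reach ◅◅ recv₁ t′ ◅ ε)
    runJointly free {x = []} {y = []} ss rr (_∷_ {e = recv m} t us) (_∷_ {e = recv n} t′ ws) α β reach =
      ⊥-elim (free _ reach (P₀.recv⇒ReceiveState sr₀ t , P₁.recv⇒ReceiveState sr₁ t′ , refl , refl))

    stateReachable : P.DeadlockFree → ∀ p → ∃ λ q → ∃₂ λ x y → Reachable ⟨ p , q ∣ x , y ⟩
    stateReachable free p with SR₀.stronglyConnected F₀.initial p | SR₀.stronglyConnected p F₀.initial
    -- Affinity speaks of loops only, so `u` is closed by `v`. Only `u` is executed; `v` supplies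
    -- `ss` and `rr`.
    ... | u , us | v , vs with proj₁ affine (u ++ v , us P₀.⋯ vs , refl , refl)
    ...   | w , ws , rec , snt = runJointly free (sent v) (received v) us ws
              (trans (sym (sent-++ u v)) (sym rec)) (trans snt (received-++ u v)) ε

    runSends : ∀ {p w p′ q x y} → p F₀.─[ w ]→* p′ → All P₀.IsSend w →
               Reachable ⟨ p , q ∣ x , y ⟩ → Reachable ⟨ p′ , q ∣ x ++ sent w , y ⟩
    runSends {x = x} {y = y} [] [] reach =
      subst (λ x → Reachable ⟨ _ , _ ∣ x , y ⟩) (sym (++-identityʳ x)) reach
    runSends {x = x} {y = y} (t ∷ ts) ((m , refl) ∷ ss) reach =
      subst (λ x → Reachable ⟨ _ , _ ∣ x , y ⟩) (++-assoc x _ _) (runSends ts ss (reach ◅◅ send₀ t ◅ ε))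

    sentNonempty : ∀ {w} → w ≢ [] → All P₀.IsSend w → 0 < length (sent w)
    sentNonempty w≢[] []               = ⊥-elim (w≢[] refl)
    sentNonempty w≢[] ((m , refl) ∷ _) = s≤s z≤n

    -- Sends never block, so the cycle can be repeated with `F₁` at rest, and each round adds at
    -- least one message to `α`.
    pump : ∀ {p w q x y} → F₀.SendCycle p w → Reachable ⟨ p , q ∣ x , y ⟩ →
           ∀ n → ∃ λ x′ → n ≤ length x′ × Reachable ⟨ p , q ∣ x′ , y ⟩
    pump cycle reach zero = _ , z≤n , reach
    pump {w = w} cycle@(w≢[] , ss , ws) reach (suc n) with pump cycle reach n
    ... | x′ , n≤ , reach′ = x′ ++ sent w , longer , runSends ws ss reach′
      where
      open ≤-Reasoning
      longer : suc n ≤ length (x′ ++ sent w)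
      longer = begin
        suc n                         ≡⟨ +-comm 1 n ⟩
        n + 1                         ≤⟨ +-mono-≤ n≤ (sentNonempty w≢[] ss) ⟩
        length x′ + length (sent w)   ≡⟨ length-++ x′ ⟨
        length (x′ ++ sent w)         ∎

    bounded⇒acyclic : P.DeadlockFree → P.BoundedChannels → ¬ F₀.HasSendCycle
    bounded⇒acyclic free (B , bound) (p , w , cycle) with stateReachable free p
    ... | q , x , y , reach with pump cycle reach (suc B)
    ...   | x′ , B<x′ , reach′ = <⇒≱ B<x′ (≤-trans (m≤m+n _ _) (bound _ reach′))

    -- Histories of global states and the bound on the channels.

    History : P.GlobalState → Set
    History ⟨ p , q ∣ x , y ⟩ = ∃₂ λ w₀ w₁ →
      F₀.initial F₀.─[ w₀ ]→* p × F₁.initial F₁.─[ w₁ ]→* q ×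
      sent w₀ ≡ received w₁ ++ x × sent w₁ ≡ received w₀ ++ y

    -- Channels are queues, so what has been sent is always what has been received followed by what
    -- is in transit, however the steps interleave.
    history-step : ∀ {s t} → Step s t → History s → History t
    history-step (send₀ {m = m} {x = x} t) (w₀ , w₁ , ts₀ , ts₁ , α , β) =
      w₀ ∷ʳ send m , w₁ , ts₀ P₀.⋯ P₀.single t , ts₁ ,
      trans (sent-++ w₀ _) (trans (cong (_++ _) α) (++-assoc (received w₁) x _)) ,
      trans β (cong (_++ _) (sym (trans (received-++ w₀ _) (++-identityʳ _))))
    history-step (recv₀ {m = m} {y = y} t) (w₀ , w₁ , ts₀ , ts₁ , α , β) =
      w₀ ∷ʳ recv m , w₁ , ts₀ P₀.⋯ P₀.single t , ts₁ ,
      trans (trans (sent-++ w₀ _) (++-identityʳ _)) α ,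
      trans β (sym (trans (cong (_++ y) (received-++ w₀ _)) (++-assoc (received w₀) _ y)))
    history-step (send₁ {m = m} {y = y} t) (w₀ , w₁ , ts₀ , ts₁ , α , β) =
      w₀ , w₁ ∷ʳ send m , ts₀ , ts₁ P₁.⋯ P₁.single t ,
      trans α (cong (_++ _) (sym (trans (received-++ w₁ _) (++-identityʳ _)))) ,
      trans (sent-++ w₁ _) (trans (cong (_++ _) β) (++-assoc (received w₀) y _))
    history-step (recv₁ {m = m} {x = x} t) (w₀ , w₁ , ts₀ , ts₁ , α , β) =
      w₀ , w₁ ∷ʳ recv m , ts₀ , ts₁ P₁.⋯ P₁.single t ,
      trans α (sym (trans (cong (_++ x) (received-++ w₁ _)) (++-assoc (received w₁) _ x))) ,
      trans (trans (sent-++ w₁ _) (++-identityʳ _)) β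

    history : ∀ {s t} → Star Step s t → History s → History t
    history ε              h = h
    history (step ◅ steps) h = history steps (history-step step h)

    -- Preceded by an access path `s`, the path `w` becomes a loop of `F₁`. A matching loop of `F₀`
    -- sends what this loop receives and receives what it sends, so `sends≤receives` for `F₀`
    -- applies. The constant `N` covers the sends of `s`.
    receives≤sends : ¬ F₀.HasSendCycle → ∃ λ N → ∀ {q w} → q F₁.─[ w ]→* F₁.initial →
                     length (received w) ≤ suc (N + length (sent w)) * F₀.size
    receives≤sends acyclic₀ = N , bound
      where
      access : ∀ q → ∃ λ s → F₁.initial F₁.─[ s ]→* q
      access = SR₁.stronglyConnected F₁.initial

      N : ℕ
      N = proj₁ (bounded (length ∘ proj₁ ∘ access))

      bound : ∀ {q w} → q F₁.─[ w ]→* F₁.initial →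
              length (received w) ≤ suc (N + length (sent w)) * F₀.size
      bound {q} {w} ws with access q | proj₂ (bounded (length ∘ proj₁ ∘ access)) q
      ... | s , ss | s≤N with proj₂ affine (s ++ w , ss P₁.⋯ ws , refl , refl)
      ...   | v , vs , snt , rec = begin
        length (received w)                                   ≤⟨ m≤n+m _ _ ⟩
        length (received s) + length (received w)             ≡⟨ length-++ (received s) ⟨
        length (received s ++ received w)                     ≡⟨ cong length (trans snt (received-++ s w)) ⟨
        length (sent v)                                       ≤⟨ P₀.sends≤receives acyclic₀ vs ⟩
        suc (length (received v)) * F₀.size                   ≡⟨ cong (λ l → suc (length l) * F₀.size) (trans rec (sent-++ s w)) ⟩
        suc (length (sent s ++ sent w)) * F₀.size             ≡⟨ cong (λ n → suc n * F₀.size) (length-++ (sent s)) ⟩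
        suc (length (sent s) + length (sent w)) * F₀.size     ≤⟨ *-monoˡ-≤ F₀.size (s≤s (+-monoˡ-≤ _ (≤-trans (length-sent-≤ s) s≤N))) ⟩
        suc (N + length (sent w)) * F₀.size                   ∎
        where open ≤-Reasoning

    acyclic⇒bounded : ¬ F₀.HasSendCycle → ¬ F₁.HasSendCycle → P.BoundedChannels
    acyclic⇒bounded acyclic₀ acyclic₁ = C + suc C * F₁.size , bound
      where
      return : ∀ p → ∃ λ v → p F₀.─[ v ]→* F₀.initial
      return p = SR₀.stronglyConnected p F₀.initial

      M N C : ℕ
      M = proj₁ (bounded (length ∘ proj₁ ∘ return))
      N = proj₁ (receives≤sends acyclic₀)
      -- Bounds the receives of a path of `F₁` that ends at the initial state and sends at most `M`
      -- messages, `M` being the maximal length of a return path of `F₀`.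
      C = suc (N + M) * F₀.size

      bound : ∀ s → Reachable s → length (P.GlobalState.chanα s) + length (P.GlobalState.chanβ s) ≤ C + suc C * F₁.size
      bound ⟨ p , q ∣ x , y ⟩ reach
        with history reach ([] , [] , F₀.[] , F₁.[] , refl , refl)
           | return p | proj₂ (bounded (length ∘ proj₁ ∘ return)) p
      ... | w₀ , w₁ , ts₀ , ts₁ , α , β | v , vs | v≤M
        with proj₁ affine (w₀ ++ v , ts₀ P₀.⋯ vs , refl , refl)
      ... | w′ , ts′ , rec′ , snt′
        -- After the sends `received w₀` are stripped, the rest `t` of `w₁` sends exactly `y`, and
        -- the rest `t′` of `w′` sends exactly what `v` receives.
        with P₁.align sr₁ (received w₀) ts₁ ts′
               (trans rec′ (trans (sent-++ w₀ v) (trans (cong (_++ sent v) α) (++-assoc (received w₁) x _))))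
               β (trans snt′ (received-++ w₀ v))
      ... | q′ , t , t′ , us , us′ , rec , snt , snt″ = +-mono-≤ x≤ y≤
        where
        open ≤-Reasoning
        t′≤C : length (received t′) ≤ C
        t′≤C = begin
          length (received t′)                        ≤⟨ proj₂ (receives≤sends acyclic₀) us′ ⟩
          suc (N + length (sent t′)) * F₀.size        ≡⟨ cong (λ l → suc (N + length l) * F₀.size) snt″ ⟩
          suc (N + length (received v)) * F₀.size     ≤⟨ *-monoˡ-≤ F₀.size (s≤s (+-monoʳ-≤ N (≤-trans (length-received-≤ v) v≤M))) ⟩
          C                                           ∎

        -- What `t` receives and the content `x` of `α` both form part of what `t′` receives, so one
        -- bound controls the two channels: `x` directly, and `y` through the sends of `t`.
        t+x≤C : length (received t) + length x ≤ C
        t+x≤C = begin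
          length (received t) + length x                       ≤⟨ +-monoʳ-≤ (length (received t)) (m≤m+n _ _) ⟩
          length (received t) + (length x + length (sent v))   ≡⟨ cong (length (received t) +_) (length-++ x) ⟨
          length (received t) + length (x ++ sent v)           ≡⟨ length-++ (received t) ⟨
          length (received t ++ (x ++ sent v))                 ≡⟨ cong length rec ⟨
          length (received t′)                                 ≤⟨ t′≤C ⟩
          C                                                    ∎

        x≤ : length x ≤ C
        x≤ = m+n≤o⇒n≤o (length (received t)) t+x≤C

        y≤ : length y ≤ suc C * F₁.size
        y≤ = begin
          length y                              ≡⟨ cong length snt ⟨
          length (sent t)                       ≤⟨ P₁.sends≤receives acyclic₁ us ⟩
          suc (length (received t)) * F₁.size   ≤⟨ *-monoˡ-≤ F₁.size (s≤s (m+n≤o⇒m≤o (length (received t)) t+x≤C)) ⟩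
          suc C * F₁.size                       ∎

theorem6p3 : ∀ {a b : ℕ} (F₀ : Machine a b) (F₁ : Machine b a) →
    IsSRMachine F₀ → IsSRMachine F₁ →
    Protocol.Affine F₀ F₁ →
    Protocol.DeadlockFree F₀ F₁ →
    Protocol.BoundedChannels F₀ F₁ ⇔ (¬ Machine.HasSendCycle F₀ × ¬ Machine.HasSendCycle F₁)
theorem6p3 F₀ F₁ sr₀ sr₁ affine free = mk⇔
  (λ bound → bounded⇒acyclic F₀ F₁ sr₀ sr₁ affine free bound ,
             bounded⇒acyclic F₁ F₀ sr₁ sr₀ (swap-Affine F₀ F₁ affine)
               (swap-DeadlockFree F₀ F₁ free) (swap-BoundedChannels F₀ F₁ bound))
  (λ (acyclic₀ , acyclic₁) → acyclic⇒bounded F₀ F₁ sr₀ sr₁ affine acyclic₀ acyclic₁)
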